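{- Let $\mathcal{T}$ be an $E$-closed set of theories, let $\mathcal{T}_0$ be an $E$-closed set of theories, and let $\mathcal{T}'_0\subseteq\mathcal{T}_0$ be a $\mathcal{T}$-relatively generating set for $\mathcal{T}_0$. Then the following conditions are equivalent: (1) $\mathcal{T}'_0$ is the $\mathcal{T}$-least generating set for $\mathcal{T}_0$; (2) $\mathcal{T}'_0$ is a $\mathcal{T}$-minimal generating set for $\mathcal{T}_0$; (3) any theory in $\mathcal{T}'_0\setminus\mathcal{T}$ is isolated by some set $(\mathcal{T}'_0\cup\mathcal{T})_\varphi$; (4) any theory in $\mathcal{T}'_0\setminus\mathcal{T}$ is isolated by some set $(\mathcal{T}_0\cup\mathcal{T})_\varphi$; (5) any theory in $\mathcal{T}'_0\setminus\mathcal{T}$ is isolated by some set $(\mathcal{T}'_0)_\varphi$; (6) any theory in $\mathcal{T}'_0\setminus\mathcal{T}$ is isolated by some set $(\mathcal{T}_0)_\varphi$.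
   Context: Languages are relational; "theory" means a complete first-order theory. All theories considered are regarded in a common language $\Sigma$ not containing the binary symbol $E$; a theory in a smaller language is regarded as a $\Sigma$-theory by declaring the missing predicates empty. $E$-combination: given $\Sigma$-structures $(\mathcal{A}_i)_{i\in I}$ (taken with pairwise disjoint universes), $\mathcal{A}_E={\rm Comb}_E(\mathcal{A}_i)_{i\in I}$ is their disjoint union (each predicate symbol is interpreted as the union of its interpretations in the $\mathcal{A}_i$) expanded by an equivalence relation $E$ whose classes are exactly the universes of the $\mathcal{A}_i$. For $\mathcal{A}'\equiv\mathcal{A}_E$, each $E$-class of $\mathcal{A}'$ is regarded as a $\Sigma$-structure (the restriction of $\mathcal{A}'$ to the class, forgetting $E$). $E$-closure: for a set $\mathcal{S}$ of theories, ${\rm Cl}_E(\mathcal{S})$ is the set of all theories ${\rm Th}(\mathcal{A})$, where $\mathcal{A}$ is the structure of some $E$-class in some $\mathcal{A}'\equiv\mathcal{A}_E$, with $\mathcal{A}_E={\rm Comb}_E(\mathcal{A}_i)_{i\in I}$ and ${\rm Th}(\mathcal{A}_i)\in\mathcal{S}$ for all $i\in I$. $\mathcal{S}$ is $E$-closed if $\mathcal{S}={\rm Cl}_E(\mathcal{S})$. Relative notions: ${\rm Cl}_{E,\mathcal{T}}(\mathcal{S})={\rm Cl}_E(\mathcal{S})\setminus\mathcal{T}$. A subset $\mathcal{T}'_0\subseteq\mathcal{T}_0$ of an $E$-closed set $\mathcal{T}_0$ is $\mathcal{T}$-relatively generating for $\mathcal{T}_0$ if $\mathcal{T}_0\setminus\mathcal{T}={\rm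 Cl}_{E,\mathcal{T}}(\mathcal{T}'_0)$. A $\mathcal{T}$-relatively generating set $\mathcal{T}'_0$ is $\mathcal{T}$-minimal if $\mathcal{T}'_0\setminus\mathcal{T}$ has no proper subset $\mathcal{T}''_0$ with $\mathcal{T}_0\setminus\mathcal{T}={\rm Cl}_{E,\mathcal{T}}((\mathcal{T}'_0\cap\mathcal{T})\cup\mathcal{T}''_0)$. A $\mathcal{T}$-minimal $\mathcal{T}$-relatively generating set $\mathcal{T}'_0$ is $\mathcal{T}$-least if $\mathcal{T}'_0\setminus\mathcal{T}\subseteq\mathcal{T}''_0\setminus\mathcal{T}$ for each $\mathcal{T}$-relatively generating set $\mathcal{T}''_0$ for $\mathcal{T}_0$. For a set $\mathcal{S}$ of theories and a sentence $\varphi$, $\mathcal{S}_\varphi=\{T\in\mathcal{S}\mid\varphi\in T\}$. A theory $T$ is isolated by the set $\mathcal{S}_\varphi$ if $\varphi\in T$ and $\mathcal{S}_\varphi=\{T\}$. -}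

module Defs where

open import Level using (Level; _⊔_) renaming (suc to lsuc)
open import Data.Empty.Polymorphic using (⊥)
open import Data.Fin.Base using (Fin; zero)
open import Data.Irrelevant using ([_])
open import Data.Maybe.Base using (Maybe; just; nothing)
open import Data.Nat.Base using (ℕ; suc; NonZero)
open import Data.Product.Base using (Σ-syntax; ∃-syntax; _×_; _,_; proj₁)
open import Data.Refinement.Base using (Refinement; value; _,_)
open import Data.Sum.Base using (_⊎_)
open import Data.Vec.Base using (Vec; []; _∷_; lookup; map)
open import Function.Bundles using (_⇔_; Equivalence)
open import Relation.Binary.PropositionalEquality.Core using (_≡_; refl)
open import Relation.Nullary.Negation.Core using (¬_)
open import Relation.Unary using (Pred; _∈_; _⊆_; _⊂_; _≐_; _∖_; _∪_; _∩_)

private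
  variable
    ℓ κ κ′ : Level

-- Predicate symbols have positive arity, as usual.  (With nullary symbols the
-- interpretation of such a symbol in a disjoint union would not be determined
-- on each summand separately.)

record Language (ℓ : Level) : Set (lsuc ℓ) where
  field
    Rel           : Set ℓ
    arity         : Rel → ℕ
    arity-nonZero : ∀ R → NonZero (arity R)

open Language public

-- First-order logic with equality.  There are no function symbols, so terms
-- are (de Bruijn) variables.  Falsum, implication and the universal quantifier
-- are primitive; excluded middle is available wherever this is used, so the
-- other connectives are definable.

module _ (L : Language ℓ) where

  infix  8 _≈′_
  infix  7 ∀′_
  infixr 6 _⇒′_

  data Formula : ℕ → Set ℓ where
    ⊥′   : ∀ {n} → Formula n
    _≈′_ : ∀ {n} → Fin n → Fin n → Formula n
    rel  : ∀ {n} (R : Rel L) → Vec (Fin n) (arity L R) → Formula n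
    _⇒′_ : ∀ {n} → Formula n → Formula n → Formula n
    ∀′_  : ∀ {n} → Formula (suc n) → Formula n

  Sentence : Set ℓ
  Sentence = Formula 0

  -- Structures live one universe above the language so that a family of
  -- structures can be indexed by an arbitrary set of theories.

  record Structure : Set (lsuc (lsuc ℓ)) where
    field
      Carrier : Set (lsuc ℓ)
      point   : Carrier
      ⟦_⟧     : (R : Rel L) → Vec Carrier (arity L R) → Set (lsuc ℓ)

  Theory : Set (lsuc ℓ)
  Theory = Pred Sentence ℓ

infix 8 ¬′_

¬′_ : {L : Language ℓ} {n : ℕ} → Formula L n → Formula L n
¬′ φ = φ ⇒′ ⊥′

open Structure public

module _ {L : Language ℓ} where

  Sat : (A : Structure L) {n : ℕ} → Vec (Carrier A) n → Formula L n → Set (lsuc ℓ)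
  Sat A ρ ⊥′         = ⊥
  Sat A ρ (x ≈′ y)   = lookup ρ x ≡ lookup ρ y
  Sat A ρ (rel R xs) = ⟦ A ⟧ R (map (lookup ρ) xs)
  Sat A ρ (φ ⇒′ ψ)   = Sat A ρ φ → Sat A ρ ψ
  Sat A ρ (∀′ φ)     = ∀ a → Sat A (a ∷ ρ) φ

  infix 4 _⊨_ _≡ₑ_

  _⊨_ : Structure L → Sentence L → Set (lsuc ℓ)
  A ⊨ φ = Sat A [] φ

  _≡ₑ_ : Structure L → Structure L → Set (lsuc ℓ)
  A ≡ₑ B = ∀ φ → (A ⊨ φ) ⇔ (B ⊨ φ)

  Th : Structure L → Pred (Sentence L) (lsuc ℓ)
  Th A φ = A ⊨ φ

  -- A satisfiable set of sentences deciding every sentence; it is then closed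
  -- under semantic consequence.

  record IsCompleteTheory (T : Theory L) : Set (lsuc (lsuc ℓ)) where
    field
      model    : Structure L
      models   : ∀ {φ} → φ ∈ T → model ⊨ φ
      complete : ∀ φ → φ ∈ T ⊎ (¬′ φ) ∈ T

  -- Theories are sets of sentences and so are identified when extensionally
  -- equal; a set of theories has to respect this identification.

  record IsTheorySet (𝒮 : Pred (Theory L) κ) : Set (lsuc (lsuc ℓ) ⊔ κ) where
    field
      theories : ∀ {T} → T ∈ 𝒮 → IsCompleteTheory T
      respects : ∀ {T T′} → T ≐ T′ → T ∈ 𝒮 → T′ ∈ 𝒮

-- The language Σ ∪ {E}, with nothing playing the role of E.

_+E : Language ℓ → Language ℓ
Rel           (L +E)          = Maybe (Rel L)
arity         (L +E) (just R) = arity L R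
arity         (L +E) nothing  = 2
arity-nonZero (L +E) (just R) = arity-nonZero L R
arity-nonZero (L +E) nothing  = _

module _ {L : Language ℓ} where

  -- Structures are nonempty, whence the index i₀.

  Comb : {I : Set (lsuc ℓ)} → I → (I → Structure L) → Structure (L +E)
  Carrier (Comb {I} i₀ A) = Σ[ i ∈ I ] Carrier (A i)
  point   (Comb i₀ A)     = i₀ , point (A i₀)
  ⟦ Comb {I} i₀ A ⟧ (just R) v =
    Σ[ i ∈ I ] Σ[ w ∈ Vec (Carrier (A i)) (arity L R) ] (⟦ A i ⟧ R w × v ≡ map (i ,_) w)
  ⟦ Comb i₀ A ⟧ nothing (x ∷ y ∷ []) = proj₁ x ≡ proj₁ y

  E[_] : (A : Structure (L +E)) → Carrier A → Carrier A → Set (lsuc ℓ)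
  E[ A ] x y = ⟦ A ⟧ nothing (x ∷ y ∷ [])

  E-reflexive : {I : Set (lsuc ℓ)} (i₀ : I) (A : I → Structure L) (A′ : Structure (L +E)) →
                A′ ≡ₑ Comb i₀ A → ∀ a → E[ A′ ] a a
  E-reflexive i₀ A A′ A′≡ =
    Equivalence.from (A′≡ (∀′ (rel nothing (zero ∷ zero ∷ [])))) (λ _ → refl)

  -- The Σ-structure on { b | E a b }; reflexivity at a makes it nonempty.

  E-class : (A : Structure (L +E)) (a : Carrier A) → E[ A ] a a → Structure L
  Carrier (E-class A a Eaa)   = Refinement (Carrier A) (E[ A ] a)
  point   (E-class A a Eaa)   = a , [ Eaa ]
  ⟦ E-class A a Eaa ⟧ R v     = ⟦ A ⟧ (just R) (map value v)

  -- Since Th lands one universe above Theory, "Th (A i) belongs to 𝒮" is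
  -- phrased through a member of 𝒮 extensionally equal to it.

  Cl-E : Pred (Theory L) κ → Pred (Theory L) (lsuc (lsuc ℓ) ⊔ κ)
  Cl-E 𝒮 T =
    Σ[ I ∈ Set (lsuc ℓ) ] Σ[ i₀ ∈ I ] Σ[ A ∈ (I → Structure L) ]
    (∀ i → ∃[ Tᵢ ] (Tᵢ ∈ 𝒮 × Th (A i) ≐ Tᵢ)) ×
    (Σ[ A′ ∈ Structure (L +E) ] Σ[ A′≡ ∈ A′ ≡ₑ Comb i₀ A ] Σ[ a ∈ Carrier A′ ]
      Th (E-class A′ a (E-reflexive i₀ A A′ A′≡ a)) ≐ T)

  E-Closed : Pred (Theory L) κ → Set (lsuc (lsuc ℓ) ⊔ κ)
  E-Closed 𝒮 = 𝒮 ≐ Cl-E 𝒮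

  RelCl-E : Pred (Theory L) κ → Pred (Theory L) κ′ → Pred (Theory L) (lsuc (lsuc ℓ) ⊔ κ ⊔ κ′)
  RelCl-E 𝒯 𝒮 = Cl-E 𝒮 ∖ 𝒯

  module _ (𝒯 𝒯₀ 𝒯₀′ : Pred (Theory L) (lsuc ℓ)) where

    IsRelGenerating : Set (lsuc (lsuc ℓ))
    IsRelGenerating = 𝒯₀′ ⊆ 𝒯₀ × (𝒯₀ ∖ 𝒯) ≐ RelCl-E 𝒯 𝒯₀′

    IsRelMinimal : Set (lsuc (lsuc ℓ))
    IsRelMinimal =
      IsRelGenerating ×
      ¬ (Σ[ 𝒯₀″ ∈ Pred (Theory L) (lsuc ℓ) ]
          IsTheorySet 𝒯₀″ × 𝒯₀″ ⊂ (𝒯₀′ ∖ 𝒯) ×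
          (𝒯₀ ∖ 𝒯) ≐ RelCl-E 𝒯 ((𝒯₀′ ∩ 𝒯) ∪ 𝒯₀″))

  IsRelLeast : (𝒯 𝒯₀ 𝒯₀′ : Pred (Theory L) (lsuc ℓ)) → Set (lsuc (lsuc ℓ))
  IsRelLeast 𝒯 𝒯₀ 𝒯₀′ =
    IsRelMinimal 𝒯 𝒯₀ 𝒯₀′ ×
    (∀ 𝒯₀″ → IsTheorySet 𝒯₀″ → IsRelGenerating 𝒯 𝒯₀ 𝒯₀″ → (𝒯₀′ ∖ 𝒯) ⊆ (𝒯₀″ ∖ 𝒯))

  infix 9 _at_

  -- 𝒮_φ
  _at_ : Pred (Theory L) κ → Sentence L → Pred (Theory L) (ℓ ⊔ κ)
  (𝒮 at φ) T = T ∈ 𝒮 × φ ∈ T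

  -- The singleton {T} is the predicate (_≐ T).
  IsIsolatedBy : Theory L → Pred (Theory L) κ → Sentence L → Set (lsuc ℓ ⊔ κ)
  IsIsolatedBy T 𝒮 φ = φ ∈ T × (𝒮 at φ) ≐ (_≐ T)

  EachIsolatedIn : Pred (Theory L) κ → Pred (Theory L) κ′ → Set (lsuc ℓ ⊔ κ ⊔ κ′)
  EachIsolatedIn 𝒫 𝒮 = ∀ T → T ∈ 𝒫 → ∃[ φ ] IsIsolatedBy T 𝒮 φ

-- A complete theory T lies in the E-closure of 𝒮 exactly when every sentence of
-- T belongs to a member of 𝒮.  One direction relativises sentences to an
-- E-class.  For the other, combine for each sentence of T infinitely many models
-- of it with theories in 𝒮, and adjoin a model M of T as one more class: in an
-- Ehrenfeucht–Fraïssé game of fixed length over finitely many symbols, M is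
-- indistinguishable from the models of a single sentence of T, of which there
-- are infinitely many already, so the two combinations are elementarily
-- equivalent.  No compactness is needed.
--
-- Granted this, a theory T outside the closed set 𝒯 contains some ψ occurring in
-- no member of 𝒯, and a sentence φ isolating T in 𝒯₀′ isolates it in its closure,
-- so φ ∧ ψ isolates T in 𝒯₀ ∪ 𝒯.  An isolated theory belongs to every generating
-- set, while one not isolated in 𝒯₀′ can be dropped from 𝒯₀′.

module Submission where

open import Defs
open import Level using (Level; lift; lower) renaming (suc to lsuc)
open import Axiom.ExcludedMiddle using (ExcludedMiddle)
open import Data.Empty using (⊥-elim)
open import Data.Fin.Base as Fin using (Fin; zero; suc)
open import Data.Irrelevant using ([_])
open import Data.List.Base as List
  using (List; []; _∷_; _++_; allFin; cartesianProductWith; catMaybes; concatMap)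
open import Data.List.Membership.Propositional using () renaming (_∈_ to _∈ₗ_)
open import Data.List.Membership.Propositional.Properties
  using (∈-++⁺ˡ; ∈-++⁺ʳ; ∈-++⁻; ∈-map⁺; ∈-map⁻; ∈-allFin; ∈-cartesianProductWith⁺; ∈-concatMap⁺)
open import Data.List.Relation.Binary.Subset.Propositional using () renaming (_⊆_ to _⊆ₗ_)
open import Data.List.Relation.Unary.Any as Any using (here; there)
open import Data.List.Properties using (Any-catMaybes⁺)
open import Data.Maybe.Base using (Maybe; just; nothing)
open import Data.Maybe.Relation.Unary.Any using (just)
open import Data.Nat.Base using (ℕ; zero; suc; _⊔_; _≤_; _<_; s≤s; NonZero)
open import Data.Nat.Properties using (m⊔n≤o⇒m≤o; m⊔n≤o⇒n≤o; m≤m⊔n; m≤n⊔m; ≤-refl; ≤-trans; <-irrefl)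
open import Data.Product.Base using (Σ; Σ-syntax; ∃-syntax; _×_; _,_; proj₁; proj₂)
open import Data.Refinement.Base using (Refinement; value; _,_)
open import Data.Sum.Base as Sum using (inj₁; inj₂; [_,_]′)
open import Data.Vec.Base using (Vec; []; _∷_; lookup; map)
open import Data.Vec.Properties using (map-∘; map-cong; lookup-map; ∷-injective)
open import Function.Base using (_∘_; id; case_of_)
open import Function.Bundles using (_⇔_; mk⇔; module Equivalence)
open import Function.Properties.Equivalence using ()
  renaming (refl to ⇔-refl; sym to ⇔-sym; trans to ⇔-trans)
open import Relation.Binary.PropositionalEquality
  using (_≡_; refl; sym; trans; cong; cong₂; subst; subst₂)
open import Relation.Nullary using (¬_; Dec; yes; no)
open import Relation.Nullary.Decidable using (decidable-stable; recompute)
open import Relation.Unary using (Pred; _∈_; _∉_; _⊆_; _≐_; _∖_; _∪_; _∩_)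
open import Relation.Unary.Properties using (≐-refl; ≐-sym; ≐-trans)

open Equivalence using (to; from)

private
  variable
    ℓ κ κ′ κ₀ : Level
    L      : Language ℓ
    k m n  : ℕ
    I I′   : Set ℓ

-- Equivalences, finite enumerations and tuples.

⇔-reflexive : {P Q : Set κ} → P ≡ Q → P ⇔ Q
⇔-reflexive refl = ⇔-refl

→-cong : {P Q P′ Q′ : Set κ} → P ⇔ P′ → Q ⇔ Q′ → (P → Q) ⇔ (P′ → Q′)
→-cong p q = mk⇔ (λ h → to q ∘ h ∘ from p) (λ h → from q ∘ h ∘ to p)

allVecs : ∀ n k → List (Vec (Fin n) k)
allVecs n zero    = [] ∷ []
allVecs n (suc k) = cartesianProductWith _∷_ (allFin n) (allVecs n k)

∈-allVecs : (xs : Vec (Fin n) k) → xs ∈ₗ allVecs n k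
∈-allVecs []       = here refl
∈-allVecs (x ∷ xs) = ∈-cartesianProductWith⁺ _∷_ (∈-allFin x) (∈-allVecs xs)

-- Serves to find a copy number larger than those of all classes already touched in a game.
bounded : {X : Set κ} (f : X → ℕ) (v : Vec X n) → ∃[ b ] ∀ x → f (lookup v x) < b
bounded f []      = 0 , λ ()
bounded f (a ∷ v) with bounded f v
... | b , <b = suc (f a) ⊔ b , λ where
  zero    → m≤m⊔n (suc (f a)) b
  (suc x) → ≤-trans (<b x) (m≤n⊔m (suc (f a)) b)

map-pair-injectiveʳ : {B : I → Set κ} {i : I} (v w : Vec (B i) k) →
                      _≡_ {A = Vec (Σ I B) k} (map (i ,_) v) (map (i ,_) w) → v ≡ w
map-pair-injectiveʳ []      []      _  = refl
map-pair-injectiveʳ (a ∷ v) (b ∷ w) eq with ∷-injective eq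
... | refl , eq′ = cong (a ∷_) (map-pair-injectiveʳ v w eq′)

-- Positive length is essential: the empty tuple would not remember its index.
map-pair-injective : {B : I → Set κ} .{{_ : NonZero k}} {i j : I} (v : Vec (B i) k) (w : Vec (B j) k) →
                     _≡_ {A = Vec (Σ I B) k} (map (i ,_) v) (map (j ,_) w) →
                     _≡_ {A = Σ[ i ∈ I ] Vec (B i) k} (i , v) (j , w)
map-pair-injective v@(_ ∷ _) w@(_ ∷ _) eq with cong proj₁ (proj₁ (∷-injective eq))
... | refl = cong (_ ,_) (map-pair-injectiveʳ v w eq)

value-injective : {X : Set κ} {P : X → Set κ′} {u v : Refinement X P} → value u ≡ value v → u ≡ v
value-injective {u = a , [ _ ]} {v = .a , [ _ ]} refl = refl

-- Ehrenfeucht-Fraïssé games.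

-- Only finitely many symbols are watched, so that a position has finitely many atomic formulas even
-- over an infinite language.
PartialIso : List (Rel L) → (A A′ : Structure L) → Vec (Carrier A) n → Vec (Carrier A′) n → Set _
PartialIso Rs A A′ ρ ρ′ =
  (∀ x y → (lookup ρ x ≡ lookup ρ y) ⇔ (lookup ρ′ x ≡ lookup ρ′ y)) ×
  (∀ {R} → R ∈ₗ Rs → ∀ xs → ⟦ A ⟧ R (map (lookup ρ) xs) ⇔ ⟦ A′ ⟧ R (map (lookup ρ′) xs))

DuplicatorWins : List (Rel L) → (A A′ : Structure L) → ℕ →
                 Vec (Carrier A) n → Vec (Carrier A′) n → Set _
DuplicatorWins Rs A A′ zero    ρ ρ′ = PartialIso Rs A A′ ρ ρ′
DuplicatorWins Rs A A′ (suc m) ρ ρ′ =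
  (∀ a  → ∃[ a′ ] DuplicatorWins Rs A A′ m (a ∷ ρ) (a′ ∷ ρ′)) ×
  (∀ a′ → ∃[ a  ] DuplicatorWins Rs A A′ m (a ∷ ρ) (a′ ∷ ρ′))

module _ {L : Language ℓ} (Rs : List (Rel L)) where

  wins-refl : (A : Structure L) → ∀ m (ρ : Vec (Carrier A) n) → DuplicatorWins Rs A A m ρ ρ
  wins-refl A zero    ρ = (λ _ _ → ⇔-refl) , λ _ _ → ⇔-refl
  wins-refl A (suc m) ρ = (λ a → a , wins-refl A m (a ∷ ρ)) , (λ a → a , wins-refl A m (a ∷ ρ))

  wins-sym : (A A′ : Structure L) → ∀ m {ρ : Vec (Carrier A) n} {ρ′} →
             DuplicatorWins Rs A A′ m ρ ρ′ → DuplicatorWins Rs A′ A m ρ′ ρ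
  wins-sym A A′ zero    (eq , rl)      = (λ x y → ⇔-sym (eq x y)) , λ R∈ xs → ⇔-sym (rl R∈ xs)
  wins-sym A A′ (suc m) (forth , back) =
    (λ a → let a′ , d = back  a in a′ , wins-sym A A′ m d) ,
    (λ a → let a′ , d = forth a in a′ , wins-sym A A′ m d)

  module _ (A A′ : Structure L) where

    private
      Wins : ℕ → Vec (Carrier A) n → Vec (Carrier A′) n → Set _
      Wins = DuplicatorWins Rs A A′

    partialIso-tail : ∀ {a a′} {ρ : Vec (Carrier A) n} {ρ′} →
                      PartialIso Rs A A′ (a ∷ ρ) (a′ ∷ ρ′) → PartialIso Rs A A′ ρ ρ′
    partialIso-tail (eq , rl) =
      (λ x y → eq (suc x) (suc y)) ,
      λ {R} R∈ xs → subst₂ (λ v v′ → ⟦ A ⟧ R v ⇔ ⟦ A′ ⟧ R v′)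
        (sym (map-∘ _ suc xs)) (sym (map-∘ _ suc xs)) (rl R∈ (map suc xs))

    -- `DuplicatorWins` inspects only the final position. Still, a round can be wasted: in the last
    -- one Spoiler plays `point A`, and the new pair is forgotten.
    wins-pred : ∀ m {ρ : Vec (Carrier A) n} {ρ′} → Wins (suc m) ρ ρ′ → Wins m ρ ρ′
    wins-pred zero    (forth , _)    = partialIso-tail (proj₂ (forth (point A)))
    wins-pred (suc m) (forth , back) =
      (λ a → let a′ , d = forth a in a′ , wins-pred m d) ,
      (λ a → let a′ , d = back  a in a′ , wins-pred m d)

    wins⇒partialIso : ∀ m {ρ : Vec (Carrier A) n} {ρ′} → Wins m ρ ρ′ → PartialIso Rs A A′ ρ ρ′
    wins⇒partialIso zero    d = d
    wins⇒partialIso (suc m) d = wins⇒partialIso m (wins-pred m d)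

rank : Formula L n → ℕ
rank (φ ⇒′ ψ) = rank φ ⊔ rank ψ
rank (∀′ φ)   = suc (rank φ)
rank _        = 0

symbols : Formula L n → List (Rel L)
symbols (rel R xs) = R ∷ []
symbols (φ ⇒′ ψ)   = symbols φ ++ symbols ψ
symbols (∀′ φ)     = symbols φ
symbols _          = []

-- Each quantifier uses up one round; rounds left over at an atomic formula are discarded.
wins⇒sat : (A A′ : Structure L) {Rs : List (Rel L)} {ρ : Vec (Carrier A) n} {ρ′ : Vec (Carrier A′) n}
           (φ : Formula L n) → rank φ ≤ m → symbols φ ⊆ₗ Rs →
           DuplicatorWins Rs A A′ m ρ ρ′ → Sat A ρ φ ⇔ Sat A′ ρ′ φ
wins⇒sat A A′ ⊥′         _ _  _ = ⇔-refl
wins⇒sat {m = m} A A′ (x ≈′ y)   _ _  d = proj₁ (wins⇒partialIso _ A A′ m d) x y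
wins⇒sat {m = m} A A′ (rel R xs) _ ⊆Rs d = proj₂ (wins⇒partialIso _ A A′ m d) (⊆Rs (here refl)) xs
wins⇒sat A A′ (φ ⇒′ ψ)   r ⊆Rs d = →-cong
  (wins⇒sat A A′ φ (m⊔n≤o⇒m≤o _ _ r) (⊆Rs ∘ ∈-++⁺ˡ) d)
  (wins⇒sat A A′ ψ (m⊔n≤o⇒n≤o (rank φ) _ r) (⊆Rs ∘ ∈-++⁺ʳ (symbols φ)) d)
wins⇒sat A A′ (∀′ φ) (s≤s r) ⊆Rs (forth , back) = mk⇔
  (λ h a′ → let a  , d = back  a′ in to   (wins⇒sat A A′ φ r ⊆Rs d) (h a))
  (λ h a  → let a′ , d = forth a  in from (wins⇒sat A A′ φ r ⊆Rs d) (h a′))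

-- Isomorphism and relativisation to an `E`-class.

module _ {A B : Structure L} (f : Carrier A → Carrier B)
         (injective  : ∀ {a b} → f a ≡ f b → a ≡ b)
         (surjective : ∀ b → ∃[ a ] f a ≡ b)
         (⟦⟧-iso     : ∀ R v → ⟦ A ⟧ R v ⇔ ⟦ B ⟧ R (map f v)) where

  iso⇒sat : (ρ : Vec (Carrier A) n) (φ : Formula L n) → Sat A ρ φ ⇔ Sat B (map f ρ) φ
  iso⇒sat ρ ⊥′         = ⇔-refl
  iso⇒sat ρ (x ≈′ y)   = subst₂ (λ b c → (lookup ρ x ≡ lookup ρ y) ⇔ (b ≡ c))
    (sym (lookup-map x f ρ)) (sym (lookup-map y f ρ)) (mk⇔ (cong f) injective)
  iso⇒sat ρ (rel R xs) = ⇔-trans (⟦⟧-iso R _) (⇔-reflexive (cong (⟦ B ⟧ R)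
    (trans (sym (map-∘ f (lookup ρ) xs)) (map-cong (λ x → sym (lookup-map x f ρ)) xs))))
  iso⇒sat ρ (φ ⇒′ ψ)   = →-cong (iso⇒sat ρ φ) (iso⇒sat ρ ψ)
  iso⇒sat ρ (∀′ φ)     = mk⇔
    (λ h b → let a , fa≡b = surjective b in
      subst (λ b → Sat B (b ∷ map f ρ) φ) fa≡b (to (iso⇒sat (a ∷ ρ) φ) (h a)))
    (λ h a → from (iso⇒sat (a ∷ ρ) φ) (h (f a)))

-- `z` names a representative of the class and need not be a variable of the original formula, so
-- the variables are carried along by `f`.
relativise : (Fin n → Fin k) → Fin k → Formula L n → Formula (L +E) k
relativise f z ⊥′         = ⊥′
relativise f z (x ≈′ y)   = f x ≈′ f y
relativise f z (rel R xs) = rel (just R) (map f xs)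
relativise f z (φ ⇒′ ψ)   = relativise f z φ ⇒′ relativise f z ψ
relativise f z (∀′ φ)     =
  ∀′ (rel nothing (suc z ∷ zero ∷ []) ⇒′ relativise (Fin.lift 1 f) (suc z) φ)

combRel : {I : Set (lsuc ℓ)} {L : Language ℓ} (i₀ : I) (A : I → Structure L) (R : Rel L) {i : I}
          (w : Vec (Carrier (A i)) (arity L R)) →
          ⟦ Comb i₀ A ⟧ (just R) (map (i ,_) w) ⇔ ⟦ A i ⟧ R w
combRel {L = L} i₀ A R w = mk⇔ to′ (λ r → _ , w , r , refl)
  where
  to′ : ⟦ Comb i₀ A ⟧ (just R) (map (_ ,_) w) → ⟦ A _ ⟧ R w
  to′ (j , w′ , r , eq) with map-pair-injective {B = Carrier ∘ A} {{arity-nonZero L R}} w w′ eq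
  ... | refl = r

-- Hintikka formulas.

infixr 6 _∧′_
infix  7 ∃′_

_∧′_ : Formula L n → Formula L n → Formula L n
φ ∧′ ψ = ¬′ (φ ⇒′ ¬′ ψ)

∃′_ : Formula L (suc n) → Formula L n
∃′ φ = ¬′ (∀′ (¬′ φ))

-- The state descriptions over a list: every assignment satisfies one of them, and two assignments
-- satisfying the same one agree on the whole list.
signings : List (Formula L n) → List (Formula L n)
signings []      = (⊥′ ⇒′ ⊥′) ∷ []
signings (φ ∷ Φ) = List.map (φ ∧′_) (signings Φ) ++ List.map (¬′ φ ∧′_) (signings Φ)

atoms : List (Rel L) → ∀ n → List (Formula L n)
atoms {L = L} Rs n =
  cartesianProductWith _≈′_ (allFin n) (allFin n) ++
  concatMap (λ R → List.map (rel R) (allVecs n (arity L R))) Rs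

-- A finite list whose truth values determine the `m`-round type of an `n`-tuple; at a successor it
-- records which types one more element can realise.
hintikka : List (Rel L) → ℕ → ∀ n → List (Formula L n)
hintikka Rs zero    n = atoms Rs n
hintikka Rs (suc m) n = List.map ∃′_ (signings (hintikka Rs m (suc n)))

module Classical (em : ∀ a → ExcludedMiddle a) where

  dne : {P : Set κ} → ¬ ¬ P → P
  dne = decidable-stable (em _)

  module _ {L : Language ℓ} (A : Structure L) {ρ : Vec (Carrier A) n} where

    sat-∧ : (φ ψ : Formula L n) → Sat A ρ (φ ∧′ ψ) ⇔ (Sat A ρ φ × Sat A ρ ψ)
    sat-∧ φ ψ = mk⇔ (λ h → dne λ k → lower (h λ p q → lift (k (p , q)))) (λ (p , q) h → h p q)

    sat-∃ : (φ : Formula L (suc n)) → Sat A ρ (∃′ φ) ⇔ (∃[ a ] Sat A (a ∷ ρ) φ)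
    sat-∃ φ = mk⇔ (λ h → dne λ k → lower (h λ a p → lift (k (a , p)))) (λ (a , p) h → h a p)

    signing-exists : (Φ : List (Formula L n)) → ∃[ θ ] (θ ∈ₗ signings Φ × Sat A ρ θ)
    signing-exists []      = ⊥′ ⇒′ ⊥′ , here refl , id
    signing-exists (φ ∷ Φ) with signing-exists Φ | em _ {P = Sat A ρ φ}
    ... | θ , θ∈ , s | yes p = φ ∧′ θ , ∈-++⁺ˡ (∈-map⁺ _ θ∈) , from (sat-∧ φ θ) (p , s)
    ... | θ , θ∈ , s | no ¬p =
      ¬′ φ ∧′ θ , ∈-++⁺ʳ _ (∈-map⁺ _ θ∈) , from (sat-∧ (¬′ φ) θ) (lift ∘ ¬p , s)

  module _ {L : Language ℓ} (A A′ : Structure L) where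

    Agree : Vec (Carrier A) n → Vec (Carrier A′) n → List (Formula L n) → Set _
    Agree ρ ρ′ Φ = ∀ {φ} → φ ∈ₗ Φ → Sat A ρ φ ⇔ Sat A′ ρ′ φ

    signing-agree : {ρ : Vec (Carrier A) n} {ρ′ : Vec (Carrier A′) n} (Φ : List (Formula L n)) →
                    ∀ {θ} → θ ∈ₗ signings Φ → Sat A ρ θ → Sat A′ ρ′ θ → Agree ρ ρ′ Φ
    signing-agree (φ ∷ Φ) θ∈ s s′ ψ∈ with ∈-++⁻ (List.map (φ ∧′_) (signings Φ)) θ∈
    ... | inj₁ θ∈ˡ with ∈-map⁻ (φ ∧′_) θ∈ˡ
    ...   | θ₀ , θ₀∈ , refl with to (sat-∧ A φ θ₀) s | to (sat-∧ A′ φ θ₀) s′ | ψ∈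
    ...     | p , _ | p′ , _ | here refl = mk⇔ (λ _ → p′) (λ _ → p)
    ...     | _ , t | _ , t′ | there ψ∈Φ = signing-agree Φ θ₀∈ t t′ ψ∈Φ
    signing-agree (φ ∷ Φ) θ∈ s s′ ψ∈ | inj₂ θ∈ʳ with ∈-map⁻ (¬′ φ ∧′_) θ∈ʳ
    ...   | θ₀ , θ₀∈ , refl with to (sat-∧ A (¬′ φ) θ₀) s | to (sat-∧ A′ (¬′ φ) θ₀) s′ | ψ∈
    ...     | ¬p , _ | ¬p′ , _ | here refl = mk⇔ (λ p → ⊥-elim (lower (¬p p))) (λ p′ → ⊥-elim (lower (¬p′ p′)))
    ...     | _ , t  | _ , t′  | there ψ∈Φ = signing-agree Φ θ₀∈ t t′ ψ∈Φ

  -- Duplicator answers with an element realising the same signing as Spoiler's: the signing,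
  -- existentially quantified, is in the list, hence has the same truth value on both sides.
  agree-hintikka⇒wins : (A A′ : Structure L) (Rs : List (Rel L)) →
                        ∀ m {ρ : Vec (Carrier A) n} {ρ′ : Vec (Carrier A′) n} →
                        Agree A A′ ρ ρ′ (hintikka Rs m n) → DuplicatorWins Rs A A′ m ρ ρ′
  agree-hintikka⇒wins {L = L} A A′ Rs zero agree =
    (λ x y → agree (∈-++⁺ˡ (∈-cartesianProductWith⁺ _≈′_ (∈-allFin x) (∈-allFin y)))) ,
    (λ R∈ xs → agree (∈-++⁺ʳ _ (∈-concatMap⁺ _
      (Any.map (λ where refl → ∈-map⁺ (rel _) (∈-allVecs xs)) R∈))))
  agree-hintikka⇒wins A A′ Rs (suc m) agree =
    (λ a → let θ , θ∈ , s = signing-exists A Φ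
               a′ , s′    = to (sat-∃ A′ θ) (to (agree (∈-map⁺ _ θ∈)) (from (sat-∃ A θ) (a , s)))
           in a′ , agree-hintikka⇒wins A A′ Rs m (signing-agree A A′ Φ θ∈ s s′)) ,
    (λ a′ → let θ , θ∈ , s′ = signing-exists A′ Φ
                a , s       = to (sat-∃ A θ) (from (agree (∈-map⁺ _ θ∈)) (from (sat-∃ A′ θ) (a′ , s′)))
            in a , agree-hintikka⇒wins A A′ Rs m (signing-agree A A′ Φ θ∈ s s′))
    where Φ = hintikka Rs m _

  -- The signing of the Hintikka list that is true in `M` condenses the `m`-round type of `M` into
  -- one sentence.
  characteristic : (M : Structure L) (Rs : List (Rel L)) (m : ℕ) →
                   ∃[ θ ] (M ⊨ θ × (∀ A → A ⊨ θ → DuplicatorWins Rs M A m [] []))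
  characteristic M Rs m with signing-exists M (hintikka Rs m 0)
  ... | θ , θ∈ , s =
    θ , s , λ A s′ → agree-hintikka⇒wins M A Rs m (signing-agree M A (hintikka Rs m 0) θ∈ s s′)

  -- Sentences true in an `E`-class.

  sat-relativise : (A : Structure (L +E)) (a : Carrier A) (e : E[ A ] a a)
                   {f : Fin n → Fin k} {z : Fin k} (ρ : Vec (Carrier A) k)
                   (σ : Vec (Carrier (E-class A a e)) n) (φ : Formula L n) →
                   lookup ρ z ≡ a → (∀ x → lookup ρ (f x) ≡ value (lookup σ x)) →
                   Sat A ρ (relativise f z φ) ⇔ Sat (E-class A a e) σ φ
  sat-relativise A a e ρ σ ⊥′         z≡ f≡ = ⇔-refl
  sat-relativise A a e ρ σ (x ≈′ y)   z≡ f≡ =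
    mk⇔ (λ p → value-injective (trans (sym (f≡ x)) (trans p (f≡ y))))
        (λ p → trans (f≡ x) (trans (cong value p) (sym (f≡ y))))
  sat-relativise A a e {f = f} ρ σ (rel R xs) z≡ f≡ = ⇔-reflexive (cong (⟦ A ⟧ (just R))
    (trans (sym (map-∘ (lookup ρ) f xs)) (trans (map-cong f≡ xs) (map-∘ value (lookup σ) xs))))
  sat-relativise A a e ρ σ (φ ⇒′ ψ)   z≡ f≡ =
    →-cong (sat-relativise A a e ρ σ φ z≡ f≡) (sat-relativise A a e ρ σ ψ z≡ f≡)
  sat-relativise A a e {f = f} {z} ρ σ (∀′ φ) refl f≡ = mk⇔
    -- Members of a class carry an irrelevant proof of `E`; excluded middle recovers a relevant one
    -- for the guard of the relativised quantifier.
    (λ { h (b , [ Eab ]) → to (ih b (b , [ Eab ]) refl) (h b (recompute (em _) Eab)) })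
    (λ h b Eab → from (ih b (b , [ Eab ]) refl) (h (b , [ Eab ])))
    where
    ih : ∀ b (β : Carrier (E-class A a e)) → b ≡ value β →
         Sat A (b ∷ ρ) (relativise (Fin.lift 1 f) (suc z) φ) ⇔ Sat (E-class A a e) (β ∷ σ) φ
    ih b β b≡ = sat-relativise A a e (b ∷ ρ) (β ∷ σ) φ refl λ where
      zero    → b≡
      (suc x) → f≡ x

  E-class-Comb : {I : Set (lsuc ℓ)} {L : Language ℓ} (i₀ : I) (A : I → Structure L) {i : I} {c : Carrier (A i)}
                 (e : E[ Comb i₀ A ] (i , c) (i , c)) →
                 A i ≡ₑ E-class (Comb i₀ A) (i , c) e
  E-class-Comb {L = L} i₀ A {i} {c} e = iso⇒sat {A = A i} {B = C} f (λ where refl → refl) surjective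
    (λ R v → ⇔-trans (⇔-sym (combRel i₀ A R v))
                     (⇔-reflexive (cong (⟦ Comb i₀ A ⟧ (just R)) (map-∘ value f v)))) []
    where
    C = E-class (Comb i₀ A) (i , c) e
    f : Carrier (A i) → Carrier C
    f a = (i , a) , [ refl ]
    surjective : ∀ b → ∃[ a ] f a ≡ b
    surjective ((j , b) , [ i≡j ]) with recompute (em _) i≡j
    ... | refl = b , refl

  -- That some class satisfies `φ` is a single sentence of the language with `E`, so it passes from
  -- `A′` to the combination, whose classes are copies of the summands.
  Cl-E-sound : {L : Language ℓ} {𝒮 : Pred (Theory L) κ} {T : Theory L} → T ∈ Cl-E 𝒮 →
               ∀ {φ} → φ ∈ T → ∃[ T′ ] (T′ ∈ 𝒮 × φ ∈ T′)
  Cl-E-sound (I , i₀ , A , A∈𝒮 , A′ , A′≡ , a , Th≐T) {φ} φ∈T =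
    let φᴱ            = relativise (λ ()) zero φ
        e             = E-reflexive i₀ A A′ A′≡ a
        A′⊨           = from (sat-relativise A′ a e (a ∷ []) [] φ refl (λ ())) (proj₂ Th≐T φ∈T)
        (i , c) , Comb⊨ = to (sat-∃ (Comb i₀ A) φᴱ) (to (A′≡ (∃′ φᴱ)) (from (sat-∃ A′ φᴱ) (a , A′⊨)))
        class⊨        = to (sat-relativise (Comb i₀ A) (i , c) refl ((i , c) ∷ []) [] φ refl (λ ())) Comb⊨
        Tᵢ , Tᵢ∈𝒮 , Th≐Tᵢ = A∈𝒮 i
    in Tᵢ , Tᵢ∈𝒮 , proj₁ Th≐Tᵢ (from (E-class-Comb i₀ A refl φ) class⊨)

  -- Games on `E`-combinations.

  -- Positions of the game on two E-combinations that restrict, on each pair of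
  -- classes touched, to part of a winning position for the two summands.
  module _ {L : Language ℓ} (Rs : List (Rel L)) where

    module _ {I I′ : Set (lsuc ℓ)} (A : I → Structure L) (A′ : I′ → Structure L) where

      private
        Position : ℕ → Set _
        Position n = Vec (Σ I (Carrier ∘ A)) n × Vec (Σ I′ (Carrier ∘ A′)) n

      -- Local tuples are only required to contain the relevant pebbles, at a common index on both
      -- sides; this avoids extracting subtuples of `ρ` and `ρ′`.
      Covers : ∀ i i′ → Vec (Carrier (A i)) k → Vec (Carrier (A′ i′)) k → Position n → Set _
      Covers i i′ σ σ′ (ρ , ρ′) = ∀ y {b b′} → lookup ρ y ≡ (i , b) → lookup ρ′ y ≡ (i′ , b′) →
                                  ∃[ z ] (lookup σ z ≡ b × lookup σ′ z ≡ b′)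

      LocallyWinning : ℕ → I → I′ → Position n → Set _
      LocallyWinning m i i′ ρρ′ = ∃[ k ] Σ[ σ ∈ Vec (Carrier (A i)) k ] Σ[ σ′ ∈ Vec (Carrier (A′ i′)) k ]
        (DuplicatorWins Rs (A i) (A′ i′) m σ σ′ × Covers i i′ σ σ′ ρρ′)

      record Matching (m : ℕ) (ρ : Vec (Σ I (Carrier ∘ A)) n) (ρ′ : Vec (Σ I′ (Carrier ∘ A′)) n) :
                      Set (lsuc ℓ) where
        field
          sameClass : ∀ x y → (proj₁ (lookup ρ x) ≡ proj₁ (lookup ρ y)) ⇔
                              (proj₁ (lookup ρ′ x) ≡ proj₁ (lookup ρ′ y))
          local     : ∀ x → LocallyWinning m (proj₁ (lookup ρ x)) (proj₁ (lookup ρ′ x)) (ρ , ρ′)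

      -- Duplicator's supply for the moment when Spoiler enters an untouched class; `v` lists the
      -- classes already used on the other side.
      HasFreshTwins : Set _
      HasFreshTwins = ∀ i m {n} (v : Vec I′ n) →
        ∃[ i′ ] ((∀ x → ¬ i′ ≡ lookup v x) × DuplicatorWins Rs (A i) (A′ i′) m [] [])

    open Matching

    matching-sym : {I I′ : Set (lsuc ℓ)} (A : I → Structure L) (A′ : I′ → Structure L) →
                   ∀ {ρ : Vec (Σ I (Carrier ∘ A)) n} {ρ′} → Matching A A′ m ρ ρ′ → Matching A′ A m ρ′ ρ
    matching-sym {m = m} A A′ M = record
      { sameClass = λ x y → ⇔-sym (sameClass M x y)
      ; local     = λ x → let k , σ , σ′ , d , cov = local M x in
          k , σ′ , σ , wins-sym Rs (A _) (A′ _) m d ,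
          λ y p q → let z , r , r′ = cov y q p in z , r′ , r
      }

    module _ {I I′ : Set (lsuc ℓ)} (A : I → Structure L) (A′ : I′ → Structure L) where

      -- Only the local game of the class just played advances; the other classes keep their
      -- positions and give up one round by `wins-pred`.
      matching-∷ : {ρ : Vec (Σ I (Carrier ∘ A)) n} {ρ′ : Vec (Σ I′ (Carrier ∘ A′)) n} →
                   Matching A A′ (suc m) ρ ρ′ →
                   ∀ {i i′ a a′} {σ : Vec (Carrier (A i)) k} {σ′ : Vec (Carrier (A′ i′)) k} →
                   (∀ y → (i ≡ proj₁ (lookup ρ y)) ⇔ (i′ ≡ proj₁ (lookup ρ′ y))) →
                   DuplicatorWins Rs (A i) (A′ i′) m (a ∷ σ) (a′ ∷ σ′) →
                   Covers A A′ i i′ σ σ′ (ρ , ρ′) →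
                   Matching A A′ m ((i , a) ∷ ρ) ((i′ , a′) ∷ ρ′)
      matching-∷ {m = m} {ρ = ρ} {ρ′} M {i} {i′} {a} {a′} {σ} {σ′} same d cov = record
        { sameClass = λ where
            zero    zero    → mk⇔ (λ _ → refl) (λ _ → refl)
            zero    (suc y) → same y
            (suc x) zero    → mk⇔ (sym ∘ to (same x) ∘ sym) (sym ∘ from (same x) ∘ sym)
            (suc x) (suc y) → sameClass M x y
        ; local = λ where
            zero    → here′
            (suc x) → there′ x (em _)
        }
        where
        ρ⁺ρ′⁺ = ((i , a) ∷ ρ) , ((i′ , a′) ∷ ρ′)
        here′ : LocallyWinning A A′ m i i′ ρ⁺ρ′⁺
        here′ = _ , a ∷ σ , a′ ∷ σ′ , d , λ where
          zero    refl refl → zero , refl , refl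
          (suc y) p    p′   → let z , q , q′ = cov y p p′ in suc z , q , q′
        there′ : ∀ x → Dec (i ≡ proj₁ (lookup ρ x)) →
                 LocallyWinning A A′ m (proj₁ (lookup ρ x)) (proj₁ (lookup ρ′ x)) ρ⁺ρ′⁺
        there′ x (yes i≡) =
          subst₂ (λ j j′ → LocallyWinning A A′ m j j′ ρ⁺ρ′⁺) i≡ (to (same x) i≡) here′
        there′ x (no i≢) with local M x
        ... | k , τ , τ′ , e , cov′ = k , τ , τ′ , wins-pred Rs (A _) (A′ _) m e , λ where
          zero    p _  → ⊥-elim (i≢ (cong proj₁ p))
          (suc y) p p′ → cov′ y p p′

      -- In a class already touched the local strategy answers. An untouched class is answered in a
      -- fresh twin, chosen for `suc m` rounds because one is played at once.
      matching-forth : HasFreshTwins A A′ → {ρ : Vec (Σ I (Carrier ∘ A)) n} {ρ′ : Vec (Σ I′ (Carrier ∘ A′)) n} →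
                       Matching A A′ (suc m) ρ ρ′ → ∀ a → ∃[ a′ ] Matching A A′ m (a ∷ ρ) (a′ ∷ ρ′)
      matching-forth {m = m} fresh {ρ} {ρ′} M (i , a) with em _ {P = ∃[ x ] i ≡ proj₁ (lookup ρ x)}
      ... | yes (x , refl) =
        let _ , σ , σ′ , (forth , _) , cov = local M x
            a′ , d = forth a
        in (_ , a′) , matching-∷ {ρ = ρ} {ρ′} M {σ = σ} {σ′} (sameClass M x) d cov
      ... | no ∄x with fresh i (suc m) (map proj₁ ρ′)
      ...   | i′ , i′∉ , (forth , _) =
        let a′ , d = forth a
        in (i′ , a′) , matching-∷ {ρ = ρ} {ρ′} M {σ = []} {[]}
             (λ y → mk⇔ (λ p → ⊥-elim (∄x (y , p))) (λ p → ⊥-elim (i′∉′ y p))) d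
             (λ y p _ → ⊥-elim (∄x (y , cong proj₁ (sym p))))
        where
        i′∉′ : ∀ y → ¬ i′ ≡ proj₁ (lookup ρ′ y)
        i′∉′ y p = i′∉ y (trans p (sym (lookup-map y proj₁ ρ′)))

      -- Indices `ys` into the local position describe the tuple on both sides at once, which
      -- reduces a predicate of the combination to one of a summand.
      localise : {ρ : Vec (Σ I (Carrier ∘ A)) n} {ρ′ : Vec (Σ I′ (Carrier ∘ A′)) n} {i : I} {i′ : I′}
                 {σ : Vec (Carrier (A i)) k} {σ′ : Vec (Carrier (A′ i′)) k} →
                 Covers A A′ i i′ σ σ′ (ρ , ρ′) →
                 (∀ y → i ≡ proj₁ (lookup ρ y) → i′ ≡ proj₁ (lookup ρ′ y)) →
                 ∀ {l} (xs : Vec (Fin n) l) w → map (lookup ρ) xs ≡ map (i ,_) w →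
                 ∃[ ys ] (w ≡ map (lookup σ) ys × map (lookup ρ′) xs ≡ map (i′ ,_) (map (lookup σ′) ys))
      localise cov same []       []      _  = [] , refl , refl
      localise {ρ = ρ} {ρ′} {σ = σ} {σ′} cov same (x ∷ xs) (b ∷ w) eq with ∷-injective eq
      ... | p , eq′ with lookup ρ′ x in p′ | same x (cong proj₁ (sym p))
      ...   | _ | refl with cov x p p′ | localise {ρ = ρ} {ρ′} {σ = σ} {σ′} cov same xs w eq′
      ...     | y , q , q′ | ys , r , r′ =
        y ∷ ys , cong₂ _∷_ (sym q) r , cong₂ _∷_ (cong (_ ,_) (sym q′)) r′

      localise-class : {ρ : Vec (Σ I (Carrier ∘ A)) n} {ρ′ : Vec (Σ I′ (Carrier ∘ A′)) n} →
                       Matching A A′ m ρ ρ′ →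
                       ∀ {l} .{{_ : NonZero l}} {i} (xs : Vec (Fin n) l) (w : Vec (Carrier (A i)) l) →
                       map (lookup ρ) xs ≡ map (i ,_) w →
                       ∃[ i′ ] ∃[ k ] Σ[ σ ∈ Vec (Carrier (A i)) k ] Σ[ σ′ ∈ Vec (Carrier (A′ i′)) k ]
                       (DuplicatorWins Rs (A i) (A′ i′) m σ σ′ ×
                        ∃[ ys ] (w ≡ map (lookup σ) ys × map (lookup ρ′) xs ≡ map (i′ ,_) (map (lookup σ′) ys)))
      localise-class {ρ = ρ} {ρ′} M xs@(x ∷ _) w@(_ ∷ _) eq with cong proj₁ (proj₁ (∷-injective eq))
      ... | refl = let k , σ , σ′ , d , cov = local M x in
        _ , k , σ , σ′ , d , localise {ρ = ρ} {ρ′} {σ = σ} {σ′} cov (λ y → to (sameClass M x y)) xs w eq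

      matching-rel : (i₀ : I) (i₀′ : I′) {ρ : Vec (Σ I (Carrier ∘ A)) n} {ρ′ : Vec (Σ I′ (Carrier ∘ A′)) n} →
                     Matching A A′ zero ρ ρ′ → ∀ {R} → R ∈ₗ Rs → ∀ xs →
                     ⟦ Comb i₀ A ⟧ (just R) (map (lookup ρ) xs) → ⟦ Comb i₀′ A′ ⟧ (just R) (map (lookup ρ′) xs)
      matching-rel i₀ i₀′ M {R} R∈ xs (i , w , r , eq) =
        let i′ , _ , σ , σ′ , (_ , rl) , ys , w≡ , eq′ = localise-class M {{arity-nonZero L R}} xs w eq
        in i′ , map (lookup σ′) ys , to (rl R∈ ys) (subst (⟦ A i ⟧ R) w≡ r) , eq′

      matching-≡ : {ρ : Vec (Σ I (Carrier ∘ A)) n} {ρ′ : Vec (Σ I′ (Carrier ∘ A′)) n} →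
                   Matching A A′ zero ρ ρ′ → ∀ x y → lookup ρ x ≡ lookup ρ y → lookup ρ′ x ≡ lookup ρ′ y
      matching-≡ {ρ = ρ} {ρ′} M x y p with local M x | to (sameClass M x y) (cong proj₁ p)
      ... | k , σ , σ′ , (eq , _) , cov | p′ with lookup ρ′ x in q | lookup ρ′ y in q′
      ...   | i′ , a′ | _ , b′ with p′
      ...     | refl with cov x refl q | cov y (sym p) q′
      ...       | z , r , r′ | z₁ , s , s′ =
        cong (i′ ,_) (trans (sym r′) (trans (to (eq z z₁) (trans r (sym s))) s′))

    matching⇒wins : {I I′ : Set (lsuc ℓ)} (A : I → Structure L) (A′ : I′ → Structure L) (i₀ : I) (i₀′ : I′)
                    {Rsᴱ : List (Rel (L +E))} → (∀ {R} → just R ∈ₗ Rsᴱ → R ∈ₗ Rs) →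
                    HasFreshTwins A A′ → HasFreshTwins A′ A → ∀ m →
                    {ρ : Vec (Σ I (Carrier ∘ A)) n} {ρ′ : Vec (Σ I′ (Carrier ∘ A′)) n} → Matching A A′ m ρ ρ′ →
                    DuplicatorWins Rsᴱ (Comb i₀ A) (Comb i₀′ A′) m ρ ρ′
    matching⇒wins A A′ i₀ i₀′ Rs⊆ fresh fresh′ zero {ρ} {ρ′} M =
      (λ x y → mk⇔ (matching-≡ A A′ M x y) (matching-≡ A′ A M′ x y)) , rels
      where
      M′ = matching-sym A A′ M
      rels : ∀ {R} → R ∈ₗ _ → ∀ xs →
             ⟦ Comb i₀ A ⟧ R (map (lookup ρ) xs) ⇔ ⟦ Comb i₀′ A′ ⟧ R (map (lookup ρ′) xs)
      rels {just R}  R∈ xs           =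
        mk⇔ (matching-rel A A′ i₀ i₀′ M (Rs⊆ R∈) xs) (matching-rel A′ A i₀′ i₀ M′ (Rs⊆ R∈) xs)
      rels {nothing} _  (x ∷ y ∷ []) = sameClass M x y
    matching⇒wins A A′ i₀ i₀′ Rs⊆ fresh fresh′ (suc m) M =
      (λ a → let a′ , N = matching-forth A A′ fresh M a in
        a′ , matching⇒wins A A′ i₀ i₀′ Rs⊆ fresh fresh′ m N) ,
      (λ a′ → let a , N = matching-forth A′ A fresh′ (matching-sym A A′ M) a′ in
        a , matching⇒wins A A′ i₀ i₀′ Rs⊆ fresh fresh′ m (matching-sym A′ A N))

  Comb-≡ₑ : {L : Language ℓ} {I I′ : Set (lsuc ℓ)} (A : I → Structure L) (A′ : I′ → Structure L)
            (i₀ : I) (i₀′ : I′) → (∀ Rs → HasFreshTwins Rs A A′) → (∀ Rs → HasFreshTwins Rs A′ A) →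
            Comb i₀ A ≡ₑ Comb i₀′ A′
  Comb-≡ₑ A A′ i₀ i₀′ fresh fresh′ φ = wins⇒sat (Comb i₀ A) (Comb i₀′ A′) φ ≤-refl id
    (matching⇒wins (catMaybes (symbols φ)) A A′ i₀ i₀′
      (λ R∈ → Any-catMaybes⁺ (Any.map (λ where refl → just refl) R∈))
      (fresh _) (fresh′ _) (rank φ) (record { sameClass = λ () ; local = λ () }))

  -- Membership in the closure, sentence by sentence.

  module _ {L : Language ℓ} {T : Theory L} (T-complete : IsCompleteTheory T) where

    open IsCompleteTheory T-complete

    model⊨⇔∈ : ∀ φ → (model ⊨ φ) ⇔ φ ∈ T
    model⊨⇔∈ φ = mk⇔ (λ s → [ id , (λ ¬φ∈T → ⊥-elim (lower (models ¬φ∈T s))) ]′ (complete φ)) models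

    Th-model : Th model ≐ T
    Th-model = (λ {φ} → to (model⊨⇔∈ φ)) , (λ {φ} → from (model⊨⇔∈ φ))

    ∧′-∈ : ∀ {φ ψ} → (φ ∧′ ψ) ∈ T ⇔ (φ ∈ T × ψ ∈ T)
    ∧′-∈ {φ} {ψ} = mk⇔
      (λ c → let p , q = to (sat-∧ model φ ψ) (models c) in to (model⊨⇔∈ φ) p , to (model⊨⇔∈ ψ) q)
      (λ (p , q) → to (model⊨⇔∈ (φ ∧′ ψ)) (from (sat-∧ model φ ψ) (models p , models q)))

    complete-⊆⇒≐ : {T′ : Theory L} → IsCompleteTheory T′ → T ⊆ T′ → T ≐ T′
    complete-⊆⇒≐ T′c T⊆T′ = T⊆T′ , λ {φ} φ∈T′ → [ id , (λ ¬φ∈T → ⊥-elim (lower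
      (IsCompleteTheory.models T′c (T⊆T′ ¬φ∈T) (IsCompleteTheory.models T′c φ∈T′)))) ]′ (complete φ)

  Cl-E-complete : {L : Language ℓ} {T : Theory L} → IsCompleteTheory T →
                  {𝒮 : Pred (Theory L) κ} → (∀ {T′} → T′ ∈ 𝒮 → IsCompleteTheory T′) →
                  (∀ {φ} → φ ∈ T → ∃[ T′ ] (T′ ∈ 𝒮 × φ ∈ T′)) → T ∈ Cl-E 𝒮
  Cl-E-complete {L = L} {T} T-complete {𝒮} complete𝒮 approx =
    Index , i₀ , A ,
    (λ ((φ , s) , _) → let T′ , T′∈𝒮 , _ = approximant {φ} s in T′ , T′∈𝒮 , Th-model (complete𝒮 T′∈𝒮)) ,
    Comb nothing A′ , Comb-≡ₑ A′ A nothing i₀ fresh fresh′ , (nothing , point model) ,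
    (λ {φ} → to (model⊨⇔∈ T-complete φ) ∘ from (class≡ φ)) ,
    (λ {φ} → to (class≡ φ) ∘ from (model⊨⇔∈ T-complete φ))
    where
    open IsCompleteTheory T-complete using (model)
    -- The copy number repeats the model of each sentence infinitely often. Truth in `model` stands
    -- in for membership in `T`, which lives one universe too low for an index set.
    Index = (∃[ φ ] model ⊨ φ) × ℕ
    i₀ : Index
    i₀ = (⊥′ ⇒′ ⊥′ , id) , 0
    approximant : ∀ {φ} → model ⊨ φ → ∃[ T′ ] (T′ ∈ 𝒮 × φ ∈ T′)
    approximant {φ} s = approx (to (model⊨⇔∈ T-complete φ) s)
    A : Index → Structure L
    A ((φ , s) , _) = IsCompleteTheory.model (complete𝒮 (proj₁ (proj₂ (approximant {φ} s))))
    A⊨ : ∀ φ (s : model ⊨ φ) k → A ((φ , s) , k) ⊨ φ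
    A⊨ φ s _ = let _ , T′∈𝒮 , φ∈T′ = approximant {φ} s in IsCompleteTheory.models (complete𝒮 T′∈𝒮) φ∈T′
    A′ : Maybe Index → Structure L
    A′ nothing  = model
    A′ (just i) = A i
    class≡ = E-class-Comb nothing A′ {nothing} {point model} refl
    fresh : ∀ Rs → HasFreshTwins Rs A′ A
    -- The twin of the added class is a copy of the model chosen for the characteristic sentence of
    -- `model`, numbered above all copies in `v`.
    fresh Rs nothing m v = let
      θ , s , wins = characteristic model Rs m
      b , <b       = bounded proj₂ v
      in ((θ , s) , b) , (λ x p → <-irrefl (cong proj₂ (sym p)) (<b x)) ,
         wins _ (A⊨ θ s b)
    fresh Rs (just (φ , _)) m v = let b , <b = bounded proj₂ v in
      (φ , b) , (λ x p → <-irrefl (cong proj₂ (sym p)) (<b x)) , wins-refl Rs _ m []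
    fresh′ : ∀ Rs → HasFreshTwins Rs A A′
    fresh′ Rs (φ , _) m v = let
      -- The added class has no copy number; `0` is a harmless default, as the answer lies above
      -- every height in `v`.
      height = λ { nothing → 0 ; (just i) → proj₂ i }
      b , <b = bounded height v
      in just (φ , b) , (λ x p → <-irrefl (cong height (sym p)) (<b x)) , wins-refl Rs _ m []

-- Monotonicity, sets of theories and isolation.

Cl-E-mono : {L : Language ℓ} {𝒮 : Pred (Theory L) κ} {𝒮′ : Pred (Theory L) κ′} → 𝒮 ⊆ 𝒮′ → Cl-E 𝒮 ⊆ Cl-E 𝒮′
Cl-E-mono 𝒮⊆𝒮′ (I , i₀ , A , A∈𝒮 , rest) =
  I , i₀ , A , (λ i → let Tᵢ , Tᵢ∈𝒮 , Th≐Tᵢ = A∈𝒮 i in Tᵢ , 𝒮⊆𝒮′ Tᵢ∈𝒮 , Th≐Tᵢ) , rest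

module _ {L : Language ℓ} where

  open IsTheorySet

  ∪-isTheorySet : {𝒮 : Pred (Theory L) κ} {𝒮′ : Pred (Theory L) κ′} →
                  IsTheorySet 𝒮 → IsTheorySet 𝒮′ → IsTheorySet (𝒮 ∪ 𝒮′)
  ∪-isTheorySet s s′ .theories     = [ theories s , theories s′ ]′
  ∪-isTheorySet s s′ .respects T≐T′ = Sum.map (respects s T≐T′) (respects s′ T≐T′)

  isolates : {𝒮 : Pred (Theory L) κ} → IsTheorySet 𝒮 → ∀ {T φ} → T ∈ 𝒮 → φ ∈ T →
             (∀ {T′} → T′ ∈ 𝒮 → φ ∈ T′ → T′ ≐ T) → IsIsolatedBy T 𝒮 φ
  isolates s T∈𝒮 φ∈T unique =
    φ∈T , (λ (T′∈𝒮 , φ∈T′) → unique T′∈𝒮 φ∈T′) , λ T′≐T → respects s (≐-sym T′≐T) T∈𝒮 , proj₂ T′≐T φ∈T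

  isolated-⊆ : {𝒫 : Pred (Theory L) κ₀} {𝒮 : Pred (Theory L) κ} {𝒮′ : Pred (Theory L) κ′} → IsTheorySet 𝒮 →
               𝒫 ⊆ 𝒮 → 𝒮 ⊆ 𝒮′ → EachIsolatedIn 𝒫 𝒮′ → EachIsolatedIn 𝒫 𝒮
  isolated-⊆ s 𝒫⊆𝒮 𝒮⊆𝒮′ iso T T∈𝒫 = let φ , φ∈T , unique , _ = iso T T∈𝒫 in
    φ , isolates s (𝒫⊆𝒮 T∈𝒫) φ∈T (λ T′∈𝒮 φ∈T′ → unique (𝒮⊆𝒮′ T′∈𝒮 , φ∈T′))

-- Generating sets relative to `𝒯`.

module Relative
  (em : ∀ a → ExcludedMiddle a) {L : Language ℓ} {𝒯 𝒯₀ 𝒯₀′ : Pred (Theory L) (lsuc ℓ)}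
  (𝒯-theories : IsTheorySet 𝒯) (𝒯₀-theories : IsTheorySet 𝒯₀) (𝒯₀′-theories : IsTheorySet 𝒯₀′)
  (𝒯-closed : E-Closed 𝒯) (generating : IsRelGenerating 𝒯 𝒯₀ 𝒯₀′) where

  open Classical em
  open IsTheorySet

  private
    𝒯₀′⊆𝒯₀ : 𝒯₀′ ⊆ 𝒯₀
    𝒯₀′⊆𝒯₀ = proj₁ generating

  separate : ∀ {T} → IsCompleteTheory T → T ∉ 𝒯 → ∃[ ψ ] (ψ ∈ T × (∀ {T′} → T′ ∈ 𝒯 → ¬ ψ ∈ T′))
  separate T-complete T∉𝒯 = dne λ ∄ψ → T∉𝒯 (proj₂ 𝒯-closed (Cl-E-complete T-complete (theories 𝒯-theories)
    λ {φ} φ∈T → dne λ ∄T′ → ∄ψ (φ , φ∈T , λ {T′} T′∈𝒯 φ∈T′ → ∄T′ (T′ , T′∈𝒯 , φ∈T′))))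

  isolated-extend : EachIsolatedIn (𝒯₀′ ∖ 𝒯) 𝒯₀′ → EachIsolatedIn (𝒯₀′ ∖ 𝒯) (𝒯₀ ∪ 𝒯)
  isolated-extend iso T T∈@(T∈𝒯₀′ , T∉𝒯) =
    φ ∧′ ψ , isolates (∪-isTheorySet 𝒯₀-theories 𝒯-theories) (inj₁ (𝒯₀′⊆𝒯₀ T∈𝒯₀′))
      (from (∧′-∈ (theories 𝒯₀′-theories T∈𝒯₀′)) (φ∈T , ψ∈T)) λ where
        (inj₁ T′∈𝒯₀) φψ∈T′ → unique₀ T′∈𝒯₀ (to (∧′-∈ (theories 𝒯₀-theories T′∈𝒯₀)) φψ∈T′)
        (inj₂ T′∈𝒯)  φψ∈T′ → ⊥-elim (ψ∉ T′∈𝒯 (proj₂ (to (∧′-∈ (theories 𝒯-theories T′∈𝒯)) φψ∈T′)))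
    where
    isolation  = iso T T∈
    separation = separate (theories 𝒯₀′-theories T∈𝒯₀′) T∉𝒯
    φ      = proj₁ isolation
    φ∈T    = proj₁ (proj₂ isolation)
    unique = proj₁ (proj₂ (proj₂ isolation))
    ψ      = proj₁ separation
    ψ∈T    = proj₁ (proj₂ separation)
    ψ∉     = proj₂ (proj₂ separation)
    unique₀ : ∀ {T′} → T′ ∈ 𝒯₀ → φ ∈ T′ × ψ ∈ T′ → T′ ≐ T
    unique₀ {T′} T′∈𝒯₀ (φ∈T′ , ψ∈T′) = complete-⊆⇒≐ T′-complete (theories 𝒯₀′-theories T∈𝒯₀′) T′⊆T
      where
      T′-complete = theories 𝒯₀-theories T′∈𝒯₀
      T′⊆T : T′ ⊆ T
      -- `ψ` keeps `T′` out of `𝒯`, so `T′` is in the closure of `𝒯₀′` and `φ ∧′ χ` occurs in some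
      -- `T*` of `𝒯₀′`; as `φ` isolates `T` there, `T*` is `T`.
      T′⊆T χ∈T′ =
        let T* , T*∈𝒯₀′ , φχ∈T* = Cl-E-sound
              (proj₁ (proj₁ (proj₂ generating) (T′∈𝒯₀ , λ T′∈𝒯 → ψ∉ T′∈𝒯 ψ∈T′)))
              (from (∧′-∈ T′-complete) (φ∈T′ , χ∈T′))
            φ∈T* , χ∈T* = to (∧′-∈ (theories 𝒯₀′-theories T*∈𝒯₀′)) φχ∈T*
        in proj₁ (unique (T*∈𝒯₀′ , φ∈T*)) χ∈T*

  -- If `T` is not isolated, each of its sentences recurs in another member of `𝒯₀′`. Removing `T`
  -- then loses no sentence, so by `Cl-E-complete` the rest still generates, against minimality.
  minimal⇒isolated : IsRelMinimal 𝒯 𝒯₀ 𝒯₀′ → EachIsolatedIn (𝒯₀′ ∖ 𝒯) 𝒯₀′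
  minimal⇒isolated (_ , minimal) T T∈@(T∈𝒯₀′ , _) = dne λ ¬isolated →
    let
      other : ∀ {χ} → χ ∈ T → ∃[ T′ ] (T′ ∈ 𝒯₀′ × χ ∈ T′ × ¬ T′ ≐ T)
      other χ∈T = dne λ ∄T′ → ¬isolated (_ , isolates 𝒯₀′-theories T∈𝒯₀′ χ∈T
        λ {T′} T′∈𝒯₀′ χ∈T′ → dne λ T′≭T → ∄T′ (T′ , T′∈𝒯₀′ , χ∈T′ , T′≭T))
      avoid : ∀ {χ T′} → T′ ∈ 𝒯₀′ → χ ∈ T′ → ∃[ T″ ] (T″ ∈ (𝒯₀′ ∩ 𝒯) ∪ 𝒳 × χ ∈ T″)
      avoid {T′ = T′} T′∈𝒯₀′ χ∈T′ = case em _ {P = T′ ≐ T} of λ where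
        (no T′≭T)  → T′ , place T′∈𝒯₀′ T′≭T , χ∈T′
        (yes T′≐T) → let T″ , T″∈𝒯₀′ , χ∈T″ , T″≭T = other (proj₁ T′≐T χ∈T′)
                     in T″ , place T″∈𝒯₀′ T″≭T , χ∈T″
    in minimal (𝒳 , 𝒳-theories , (proj₁ , λ ⊆𝒳 → proj₂ (⊆𝒳 T∈) ≐-refl) ,
      (λ {U} U∈@(U∈𝒯₀ , U∉𝒯) → Cl-E-complete (theories 𝒯₀-theories U∈𝒯₀) (theories 𝒯₀′-theories ∘ ⊆𝒯₀′)
         (λ χ∈U → let T′ , T′∈𝒯₀′ , χ∈T′ = Cl-E-sound (proj₁ (proj₁ (proj₂ generating) U∈)) χ∈U
                  in avoid T′∈𝒯₀′ χ∈T′) , U∉𝒯) ,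
      (λ (U∈Cl , U∉𝒯) → proj₂ (proj₂ generating) (Cl-E-mono ⊆𝒯₀′ U∈Cl , U∉𝒯)))
    where
    𝒳 : Pred (Theory L) (lsuc ℓ)
    𝒳 T′ = T′ ∈ 𝒯₀′ ∖ 𝒯 × ¬ T′ ≐ T
    𝒳-theories : IsTheorySet 𝒳
    𝒳-theories .theories ((T′∈𝒯₀′ , _) , _) = theories 𝒯₀′-theories T′∈𝒯₀′
    𝒳-theories .respects T′≐T″ ((T′∈𝒯₀′ , T′∉𝒯) , T′≭T) =
      (respects 𝒯₀′-theories T′≐T″ T′∈𝒯₀′ , T′∉𝒯 ∘ respects 𝒯-theories (≐-sym T′≐T″)) ,
      T′≭T ∘ ≐-trans T′≐T″
    ⊆𝒯₀′ : (𝒯₀′ ∩ 𝒯) ∪ 𝒳 ⊆ 𝒯₀′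
    ⊆𝒯₀′ = [ proj₁ , proj₁ ∘ proj₁ ]′
    place : ∀ {T′} → T′ ∈ 𝒯₀′ → ¬ T′ ≐ T → T′ ∈ (𝒯₀′ ∩ 𝒯) ∪ 𝒳
    place {T′} T′∈𝒯₀′ T′≭T with em _ {P = T′ ∈ 𝒯}
    ... | yes T′∈𝒯 = inj₁ (T′∈𝒯₀′ , T′∈𝒯)
    ... | no  T′∉𝒯 = inj₂ ((T′∈𝒯₀′ , T′∉𝒯) , T′≭T)

  isolated⇒least : EachIsolatedIn (𝒯₀′ ∖ 𝒯) (𝒯₀ ∪ 𝒯) → IsRelLeast 𝒯 𝒯₀ 𝒯₀′
  isolated⇒least iso = (generating , minimal) , least
    where
    -- Some member of `𝒮` contains the isolating sentence of `T` and is therefore `T`. Leastness and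
    -- minimality both rest on this.
    approximated : ∀ {𝒮 : Pred (Theory L) (lsuc ℓ)} → IsTheorySet 𝒮 → 𝒮 ⊆ 𝒯₀ → 𝒯₀ ∖ 𝒯 ⊆ RelCl-E 𝒯 𝒮 →
                   𝒯₀′ ∖ 𝒯 ⊆ 𝒮
    approximated 𝒮-theories 𝒮⊆𝒯₀ gen {T} T∈@(T∈𝒯₀′ , T∉𝒯) =
      let φ , φ∈T , unique , _ = iso T T∈
          T′ , T′∈𝒮 , φ∈T′ = Cl-E-sound (proj₁ (gen (𝒯₀′⊆𝒯₀ T∈𝒯₀′ , T∉𝒯))) φ∈T
      in respects 𝒮-theories (unique (inj₁ (𝒮⊆𝒯₀ T′∈𝒮) , φ∈T′)) T′∈𝒮
    least : ∀ 𝒮 → IsTheorySet 𝒮 → IsRelGenerating 𝒯 𝒯₀ 𝒮 → 𝒯₀′ ∖ 𝒯 ⊆ 𝒮 ∖ 𝒯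
    least 𝒮 𝒮-theories (𝒮⊆𝒯₀ , gen) T∈ = approximated 𝒮-theories 𝒮⊆𝒯₀ (proj₁ gen) T∈ , proj₂ T∈
    minimal : ¬ _
    -- Here the generating set is `(𝒯₀′ ∩ 𝒯) ∪ 𝒳`: a theory outside `𝒯` has to fall into `𝒳`, so `𝒳`
    -- is not a proper subset.
    minimal (𝒳 , 𝒳-theories , (𝒳⊆ , ⊈𝒳) , gen) = ⊈𝒳 λ {T} T∈ →
      [ (λ T∈∩ → ⊥-elim (proj₂ T∈ (proj₂ T∈∩))) , id ]′
      (approximated (∪-isTheorySet ∩-theories 𝒳-theories) (𝒯₀′⊆𝒯₀ ∘ [ proj₁ , proj₁ ∘ 𝒳⊆ ]′) (proj₁ gen) T∈)
      where
      ∩-theories : IsTheorySet (𝒯₀′ ∩ 𝒯)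
      ∩-theories .theories          (T∈𝒯₀′ , _)   = theories 𝒯₀′-theories T∈𝒯₀′
      ∩-theories .respects T≐T′ (T∈𝒯₀′ , T∈𝒯) =
        respects 𝒯₀′-theories T≐T′ T∈𝒯₀′ , respects 𝒯-theories T≐T′ T∈𝒯

theorem4p2 :
    (∀ a → ExcludedMiddle a) →
    (ℓ : Level) (L : Language ℓ)
    (𝒯 𝒯₀ 𝒯₀′ : Pred (Theory L) (lsuc ℓ)) →
    IsTheorySet 𝒯 → IsTheorySet 𝒯₀ → IsTheorySet 𝒯₀′ →
    E-Closed 𝒯 → E-Closed 𝒯₀ →
    IsRelGenerating 𝒯 𝒯₀ 𝒯₀′ →
    let ⟨1⟩ = IsRelLeast 𝒯 𝒯₀ 𝒯₀′
        ⟨2⟩ = IsRelMinimal 𝒯 𝒯₀ 𝒯₀′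
        ⟨3⟩ = EachIsolatedIn (𝒯₀′ ∖ 𝒯) (𝒯₀′ ∪ 𝒯)
        ⟨4⟩ = EachIsolatedIn (𝒯₀′ ∖ 𝒯) (𝒯₀ ∪ 𝒯)
        ⟨5⟩ = EachIsolatedIn (𝒯₀′ ∖ 𝒯) 𝒯₀′
        ⟨6⟩ = EachIsolatedIn (𝒯₀′ ∖ 𝒯) 𝒯₀
    in (⟨1⟩ ⇔ ⟨2⟩) × (⟨2⟩ ⇔ ⟨3⟩) × (⟨3⟩ ⇔ ⟨4⟩) × (⟨4⟩ ⇔ ⟨5⟩) × (⟨5⟩ ⇔ ⟨6⟩)
theorem4p2 em ℓ L 𝒯 𝒯₀ 𝒯₀′ 𝒯-theories 𝒯₀-theories 𝒯₀′-theories 𝒯-closed _ generating =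
  mk⇔ proj₁ (5⇒1 ∘ 2⇒5) ,
  mk⇔ (4⇒3 ∘ 5⇒4 ∘ 2⇒5) (proj₁ ∘ 5⇒1 ∘ 3⇒5) ,
  mk⇔ (5⇒4 ∘ 3⇒5) 4⇒3 ,
  mk⇔ (3⇒5 ∘ 4⇒3) 5⇒4 ,
  mk⇔ (4⇒6 ∘ 5⇒4) 6⇒5
  where
  -- Shrinking the ambient set gives (4) ⇒ (3) ⇒ (5) and (4) ⇒ (6) ⇒ (5); the cycle (5) ⇒ (4) ⇒ (1)
  -- ⇒ (2) ⇒ (5) does the rest.
  open Relative em 𝒯-theories 𝒯₀-theories 𝒯₀′-theories 𝒯-closed generating
    renaming (minimal⇒isolated to 2⇒5; isolated-extend to 5⇒4)
  5⇒1 = isolated⇒least ∘ 5⇒4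
  4⇒3 = isolated-⊆ (∪-isTheorySet 𝒯₀′-theories 𝒯-theories) (inj₁ ∘ proj₁) (Sum.map₁ (proj₁ generating))
  4⇒6 = isolated-⊆ 𝒯₀-theories (proj₁ generating ∘ proj₁) inj₁
  3⇒5 = isolated-⊆ 𝒯₀′-theories proj₁ inj₁
  6⇒5 = isolated-⊆ 𝒯₀′-theories proj₁ (proj₁ generating)
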